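{- For every real number $a$, every positive integer $m$ and every integer $n\ge 0$, the value of the $n$-th Bernoulli polynomial at $-a/m$ satisfies $$B_n\left(\frac{ -a}{m}\right)=\sum_{k=0}^{n}k!\,\widetilde{W}_{m,a}(n,k)\,\frac{(-1)^k}{m^{n-k}(k+1)}.$$
   Context: For a real number $a$, a positive integer $m$ and integers $n,k\ge 0$, the noncentral Whitney numbers of the second kind are given by $$\widetilde{W}_{m,a}(n,k)=\frac{1}{m^k k!}\sum_{j=0}^{k}\binom{k}{j}(-1)^{k-j}(mj-a)^n,$$ with the convention $0^0=1$. $B_n(t)$ denotes the $n$-th Bernoulli polynomial, defined by $\sum_{n=0}^{\infty}B_n(t)\frac{z^n}{n!}=\frac{z e^{tz}}{e^z-1}$. -}

module Defs where

open import Algebra.Bundles using (CommutativeRing)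
import Algebra.Properties.Ring
import Algebra.Properties.Semiring.Exp
import Algebra.Properties.Semiring.Sum
open import Data.Fin.Base using (toℕ)
import Data.Integer.Base as ℤ
open import Data.Nat.Base as ℕ using (ℕ; zero; suc; NonZero; _∸_; _!; _⊔_)
open import Data.Nat.Combinatorics using (_C_)
import Data.Nat.Properties as ℕ
open import Data.Nat.Properties using (_!≢0)
open import Data.Product.Base using (∃-syntax; _×_; _,_)
open import Data.Rational.Base as ℚ using (ℚ; 0ℚ; 1ℚ; ½; ∣_∣; Positive)
import Data.Rational.Properties as ℚ
import Data.Rational.Unnormalised.Base as ℚᵘ
import Data.Rational.Unnormalised.Properties as ℚᵘ
open import Data.Rational.Solver using (module +-*-Solver)
open import Function.Base using (it)
open import Level using (0ℓ)
open import Relation.Binary.PropositionalEquality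
  using (_≡_; refl; sym; trans; cong; subst; module ≡-Reasoning)
open +-*-Solver using (solve; _:+_; _:*_; _:-_; :-_; _:=_)

infix 4 _~_ _≈ᵣ_

-- A partial equivalence relation: x ~ x says that x is Cauchy, and for
-- Cauchy x and y, x ~ y says that x i - y i tends to 0.
_~_ : (ℕ → ℚ) → (ℕ → ℚ) → Set
x ~ y = ∀ ε → .{{Positive ε}} →
        ∃[ N ] (∀ i j → N ℕ.≤ i → N ℕ.≤ j → ∣ x i ℚ.- y j ∣ ℚ.≤ ε)

-- With eta-equality switched off and the operations below defined by
-- copatterns, conversion checking does not compare the cauchy fields.
record ℝ : Set where
  no-eta-equality
  field
    seq    : ℕ → ℚ
    cauchy : seq ~ seq

open ℝ public

record _≈ᵣ_ (x y : ℝ) : Set where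
  constructor mk≈
  field
    close : seq x ~ seq y

open _≈ᵣ_ public

private

  dist-sym : ∀ p q → ∣ p ℚ.- q ∣ ≡ ∣ q ℚ.- p ∣
  dist-sym p q = trans (sym (ℚ.∣-p∣≡∣p∣ (p ℚ.- q)))
    (cong ∣_∣ (solve 2 (λ a b → :- (a :- b) := b :- a) refl p q))

  ½+½ : ∀ ε → ε ℚ.* ½ ℚ.+ ε ℚ.* ½ ≡ ε
  ½+½ ε = trans (sym (ℚ.*-distribˡ-+ ε ½ ½)) (ℚ.*-identityʳ ε)

  half-pos : ∀ ε → .{{Positive ε}} → Positive (ε ℚ.* ½)
  half-pos ε = ℚ.pos*pos⇒pos ε ½

  ~-reflexive : ∀ {x y} → x ~ x → (∀ i → x i ≡ y i) → x ~ y
  ~-reflexive {x} x~x x≗y ε with x~x ε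
  ... | N , h = N , λ i j N≤i N≤j →
    subst (λ q → ∣ x i ℚ.- q ∣ ℚ.≤ ε) (x≗y j) (h i j N≤i N≤j)

  ~-sym : ∀ {x y} → x ~ y → y ~ x
  ~-sym {x} {y} x~y ε with x~y ε
  ... | N , h = N , λ i j N≤i N≤j →
    subst (ℚ._≤ ε) (dist-sym (x j) (y i)) (h j i N≤j N≤i)

  split : ∀ {p q r ε} → p ≡ q ℚ.+ r →
          ∣ q ∣ ℚ.≤ ε ℚ.* ½ → ∣ r ∣ ℚ.≤ ε ℚ.* ½ → ∣ p ∣ ℚ.≤ ε
  split {q = q} {r} {ε} refl q≤ r≤ =
    ℚ.≤-trans (ℚ.∣p+q∣≤∣p∣+∣q∣ q r)
      (subst (∣ q ∣ ℚ.+ ∣ r ∣ ℚ.≤_) (½+½ ε) (ℚ.+-mono-≤ q≤ r≤))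

  ~-trans : ∀ {x y z} → x ~ y → y ~ z → x ~ z
  ~-trans {x} {y} {z} x~y y~z ε
    with x~y (ε ℚ.* ½) {{half-pos ε}} | y~z (ε ℚ.* ½) {{half-pos ε}}
  ... | M , h | N , k = M ⊔ N , λ i j p q →
    split (solve 3 (λ a b c → a :- c := (a :- b) :+ (b :- c)) refl
             (x i) (y (M ⊔ N)) (z j))
          (h i (M ⊔ N) (ℕ.m⊔n≤o⇒m≤o M N p) (ℕ.m≤m⊔n M N))
          (k (M ⊔ N) j (ℕ.m≤n⊔m M N) (ℕ.m⊔n≤o⇒n≤o M N q))

  +-~ : ∀ {x y u v} → x ~ y → u ~ v →
        (λ i → x i ℚ.+ u i) ~ (λ i → y i ℚ.+ v i)
  +-~ {x} {y} {u} {v} x~y u~v ε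
    with x~y (ε ℚ.* ½) {{half-pos ε}} | u~v (ε ℚ.* ½) {{half-pos ε}}
  ... | M , h | N , k = M ⊔ N , λ i j p q →
    split (solve 4 (λ a b c d → (a :+ c) :- (b :+ d) := (a :- b) :+ (c :- d))
             refl (x i) (y j) (u i) (v j))
          (h i j (ℕ.m⊔n≤o⇒m≤o M N p) (ℕ.m⊔n≤o⇒m≤o M N q))
          (k i j (ℕ.m⊔n≤o⇒n≤o M N p) (ℕ.m⊔n≤o⇒n≤o M N q))

  neg-~ : ∀ {x y} → x ~ y → (λ i → ℚ.- x i) ~ (λ i → ℚ.- y i)
  neg-~ {x} {y} x~y ε with x~y ε
  ... | N , h = N , λ i j p q →
    subst (ℚ._≤ ε)
      (trans (dist-sym (x i) (y j)) (cong ∣_∣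
        (solve 2 (λ a b → b :- a := (:- a) :- (:- b)) refl (x i) (y j))))
      (h i j p q)

  bounded : ∀ {x y} → x ~ y →
            ∃[ B ] (Positive B × ∃[ N ] (∀ i → N ℕ.≤ i → ∣ x i ∣ ℚ.≤ B))
  bounded {x} {y} x~y with x~y 1ℚ
  ... | N , h = 1ℚ ℚ.+ ∣ y N ∣
              , ℚ.pos+nonNeg⇒pos 1ℚ ∣ y N ∣ {{ℚ.∣-∣-nonNeg (y N)}}
              , N
              , λ i p → ℚ.≤-trans
                  (subst (λ q → ∣ q ∣ ℚ.≤ ∣ x i ℚ.- y N ∣ ℚ.+ ∣ y N ∣)
                     (solve 2 (λ a b → (a :- b) :+ b := a) refl (x i) (y N))
                     (ℚ.∣p+q∣≤∣p∣+∣q∣ (x i ℚ.- y N) (y N)))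
                  (ℚ.+-monoˡ-≤ ∣ y N ∣ (h i N p ℕ.≤-refl))

  scale : ∀ B ε → Positive B → Positive ε →
          ∃[ δ ] (Positive δ ×
            (∀ p q → ∣ p ∣ ℚ.≤ B → ∣ q ∣ ℚ.≤ δ → ∣ p ℚ.* q ∣ ℚ.≤ ε))
  scale B ε B>0 ε>0 = ε ℚ.* B⁻¹ , ℚ.pos*pos⇒pos ε {{ε>0}} B⁻¹ {{ℚ.1/pos⇒pos B {{B>0}}}} ,
    λ p q p≤ q≤ → begin
      ∣ p ℚ.* q ∣        ≡⟨ ℚ.∣p*q∣≡∣p∣*∣q∣ p q ⟩
      ∣ p ∣ ℚ.* ∣ q ∣    ≤⟨ ℚ.*-monoʳ-≤-nonNeg ∣ q ∣ {{ℚ.∣-∣-nonNeg q}} p≤ ⟩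
      B ℚ.* ∣ q ∣        ≤⟨ ℚ.*-monoˡ-≤-nonNeg B {{ℚ.pos⇒nonNeg B {{B>0}}}} q≤ ⟩
      B ℚ.* (ε ℚ.* B⁻¹)  ≡⟨ cong (B ℚ.*_) (ℚ.*-comm ε B⁻¹) ⟩
      B ℚ.* (B⁻¹ ℚ.* ε)  ≡⟨ sym (ℚ.*-assoc B B⁻¹ ε) ⟩
      B ℚ.* B⁻¹ ℚ.* ε    ≡⟨ cong (ℚ._* ε) (ℚ.*-inverseʳ B {{B≢0}}) ⟩
      1ℚ ℚ.* ε           ≡⟨ ℚ.*-identityˡ ε ⟩
      ε                  ∎
    where
    open ℚ.≤-Reasoning
    B≢0 = ℚ.pos⇒nonZero B {{B>0}}
    B⁻¹ = ℚ.1/_ B {{B≢0}}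

  *-diff : ∀ a b c d → a ℚ.* c ℚ.- b ℚ.* d ≡ a ℚ.* (c ℚ.- d) ℚ.+ d ℚ.* (a ℚ.- b)
  *-diff = solve 4 (λ a b c d → a :* c :- b :* d := a :* (c :- d) :+ d :* (a :- b))
             refl

  *-~ : ∀ {x y u v} → x ~ y → u ~ v →
        (λ i → x i ℚ.* u i) ~ (λ i → y i ℚ.* v i)
  *-~ {x} {y} {u} {v} x~y u~v ε =
    let B , B>0 , K , x≤B = bounded {x} {y} x~y
        D , D>0 , L , v≤D = bounded {v} {u} (~-sym {u} {v} u~v)
        δ , δ>0 , xδ = scale B (ε ℚ.* ½) B>0 (half-pos ε)
        η , η>0 , vη = scale D (ε ℚ.* ½) D>0 (half-pos ε)
        M , u~v≤δ = u~v δ {{δ>0}}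
        N , x~y≤η = x~y η {{η>0}}
    in (K ⊔ L) ⊔ (M ⊔ N) , λ i j p q →
    let KL≤i = ℕ.m⊔n≤o⇒m≤o (K ⊔ L) (M ⊔ N) p
        MN≤i = ℕ.m⊔n≤o⇒n≤o (K ⊔ L) (M ⊔ N) p
        KL≤j = ℕ.m⊔n≤o⇒m≤o (K ⊔ L) (M ⊔ N) q
        MN≤j = ℕ.m⊔n≤o⇒n≤o (K ⊔ L) (M ⊔ N) q
    in split {ε = ε} (*-diff (x i) (y j) (u i) (v j))
         (xδ (x i) (u i ℚ.- v j) (x≤B i (ℕ.m⊔n≤o⇒m≤o K L KL≤i))
            (u~v≤δ i j (ℕ.m⊔n≤o⇒m≤o M N MN≤i) (ℕ.m⊔n≤o⇒m≤o M N MN≤j)))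
         (vη (v j) (x i ℚ.- y j) (v≤D j (ℕ.m⊔n≤o⇒n≤o K L KL≤j))
            (x~y≤η i j (ℕ.m⊔n≤o⇒n≤o M N MN≤i) (ℕ.m⊔n≤o⇒n≤o M N MN≤j)))

  const-~ : ∀ q → (λ _ → q) ~ (λ _ → q)
  const-~ q ε = 0 , λ _ _ _ _ →
    subst (λ r → ∣ r ∣ ℚ.≤ ε) (sym (ℚ.+-inverseʳ q))
      (ℚ.nonNegative⁻¹ ε {{ℚ.pos⇒nonNeg ε}})

fromℚ : ℚ → ℝ
seq    (fromℚ q) = λ _ → q
cauchy (fromℚ q) = const-~ q

fromℕ : ℕ → ℝ
fromℕ n = fromℚ (ℤ.+ n ℚ./ 1)

infixl 6 _+ᵣ_
infixl 7 _*ᵣ_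
infix  8 -ᵣ_

_+ᵣ_ _*ᵣ_ : ℝ → ℝ → ℝ
seq    (x +ᵣ y) i = seq x i ℚ.+ seq y i
cauchy (x +ᵣ y)   =
  +-~ {seq x} {seq x} {seq y} {seq y} (cauchy x) (cauchy y)
seq    (x *ᵣ y) i = seq x i ℚ.* seq y i
cauchy (x *ᵣ y)   =
  *-~ {seq x} {seq x} {seq y} {seq y} (cauchy x) (cauchy y)

-ᵣ_ : ℝ → ℝ
seq    (-ᵣ x) i = ℚ.- seq x i
cauchy (-ᵣ x)   = neg-~ {seq x} {seq x} (cauchy x)

≗⇒≈ : ∀ {x y} → (∀ i → seq x i ≡ seq y i) → x ≈ᵣ y
≗⇒≈ {x} {y} x≗y = mk≈ (~-reflexive {seq x} {seq y} (cauchy x) x≗y)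

ℝ-commutativeRing : CommutativeRing 0ℓ 0ℓ
ℝ-commutativeRing = record
  { Carrier = ℝ
  ; _≈_     = _≈ᵣ_
  ; _+_     = _+ᵣ_
  ; _*_     = _*ᵣ_
  ; -_      = -ᵣ_
  ; 0#      = fromℚ 0ℚ
  ; 1#      = fromℚ 1ℚ
  ; isCommutativeRing = record
    { isRing = record
      { +-isAbelianGroup = record
        { isGroup = record
          { isMonoid = record
            { isSemigroup = record
              { isMagma = record
                { isEquivalence = record
                  { refl  = λ {x} → mk≈ (cauchy x)
                  ; sym   = λ {x} {y} p → mk≈ (~-sym {seq x} {seq y} (close p))
                  ; trans = λ {x} {y} {z} p q →
                      mk≈ (~-trans {seq x} {seq y} {seq z} (close p) (close q))
                  }
                ; ∙-cong = λ {x} {y} {u} {v} p q →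
                    mk≈ (+-~ {seq x} {seq y} {seq u} {seq v} (close p) (close q))
                }
              ; assoc = λ x y z →
                  ≗⇒≈ λ i → ℚ.+-assoc (seq x i) (seq y i) (seq z i)
              }
            ; identity = (λ x → ≗⇒≈ λ i → ℚ.+-identityˡ (seq x i))
                       , (λ x → ≗⇒≈ λ i → ℚ.+-identityʳ (seq x i))
            }
          ; inverse = (λ x → ≗⇒≈ λ i → ℚ.+-inverseˡ (seq x i))
                    , (λ x → ≗⇒≈ λ i → ℚ.+-inverseʳ (seq x i))
          ; ⁻¹-cong = λ {x} {y} p → mk≈ (neg-~ {seq x} {seq y} (close p))
          }
        ; comm = λ x y → ≗⇒≈ λ i → ℚ.+-comm (seq x i) (seq y i)
        }
      ; *-cong = λ {x} {y} {u} {v} p q →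
          mk≈ (*-~ {seq x} {seq y} {seq u} {seq v} (close p) (close q))
      ; *-assoc = λ x y z →
          ≗⇒≈ λ i → ℚ.*-assoc (seq x i) (seq y i) (seq z i)
      ; *-identity = (λ x → ≗⇒≈ λ i → ℚ.*-identityˡ (seq x i))
                   , (λ x → ≗⇒≈ λ i → ℚ.*-identityʳ (seq x i))
      ; distrib = (λ x y z → ≗⇒≈ λ i →
                     ℚ.*-distribˡ-+ (seq x i) (seq y i) (seq z i))
                , (λ x y z → ≗⇒≈ λ i →
                     ℚ.*-distribʳ-+ (seq x i) (seq y i) (seq z i))
      }
    ; *-comm = λ x y → ≗⇒≈ λ i → ℚ.*-comm (seq x i) (seq y i)
    }
  }

open CommutativeRing ℝ-commutativeRing public
  using (_≈_; _+_; _*_; -_; _-_; 0#; 1#)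

open Algebra.Properties.Semiring.Exp
  (CommutativeRing.semiring ℝ-commutativeRing) public using (_^_)

open Algebra.Properties.Semiring.Sum
  (CommutativeRing.semiring ℝ-commutativeRing) public
  using (sum⁺-syntax; sum-cong-≋)

infixl 7 _/_

_/_ : ℝ → (d : ℕ) → .{{NonZero d}} → ℝ
x / d = x * fromℚ (ℤ.+ 1 ℚ./ d)

m^i*j≢0 : ∀ m i j → .{{NonZero m}} → .{{NonZero j}} → NonZero (m ℕ.^ i ℕ.* j)
m^i*j≢0 m i j = ℕ.m*n≢0 (m ℕ.^ i) j {{ℕ.m^n≢0 m i}}

-- f stands for the formal power series Σ f n zⁿ.
Series : Set
Series = ℕ → ℝ

infix 4 _≋_

_≋_ : Series → Series → Set
f ≋ g = ∀ n → f n ≈ g n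

infixl 7 _⊛_ _⊘_

_⊛_ : Series → Series → Series
(f ⊛ g) n = ∑[ i ≤ n ] (f (toℕ i) * g (n ∸ toℕ i))

tail : Series → Series
tail f n = f (suc n)

-- Quotient by a series with constant coefficient 1, by long division.
-- For other divisors the value is meaningless.
_⊘_ : Series → Series → Series
(f ⊘ g) zero    = f 0
(f ⊘ g) (suc n) = ((λ i → tail f i - f 0 * tail g i) ⊘ g) n

oneˢ : Series
oneˢ zero    = 1#
oneˢ (suc _) = 0#

infixr 8 z·_

z·_ : Series → Series
(z· f) zero    = 0#
(z· f) (suc n) = f n

-- The series of e^{tz}.
exp : ℝ → Series
exp t n = (t ^ n / n !) {{n !≢0}}

expm1 : Series
expm1 n = exp 1# n - oneˢ n

-- z e^{tz} / (e^z - 1), with the common factor z cancelled.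
bernoulliSeries : ℝ → Series
bernoulliSeries t = exp t ⊘ tail expm1

bernoulli : ℕ → ℝ → ℝ
bernoulli n t = fromℕ (n !) * bernoulliSeries t n

private
  n*1/n : ∀ d → .{{_ : NonZero d}} → (ℤ.+ d ℚ./ 1) ℚ.* (ℤ.+ 1 ℚ./ d) ≡ 1ℚ
  n*1/n d@(suc d-1) = ℚ.toℚᵘ-injective (begin
    ℚ.toℚᵘ ((ℤ.+ d ℚ./ 1) ℚ.* (ℤ.+ 1 ℚ./ d))
      ≈⟨ ℚ.toℚᵘ-homo-* (ℤ.+ d ℚ./ 1) (ℤ.+ 1 ℚ./ d) ⟩
    ℚ.toℚᵘ (ℤ.+ d ℚ./ 1) ℚᵘ.* ℚ.toℚᵘ (ℤ.+ 1 ℚ./ d)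
      ≈⟨ ℚᵘ.*-cong (ℚ.toℚᵘ-fromℚᵘ p) (ℚ.toℚᵘ-fromℚᵘ (ℚᵘ.1/ p)) ⟩
    p ℚᵘ.* ℚᵘ.1/ p
      ≈⟨ ℚᵘ.*-inverseʳ p ⟩
    ℚᵘ.1ℚᵘ
      ∎)
    where
    open ℚᵘ.≃-Reasoning
    p = ℚᵘ.mkℚᵘ (ℤ.+ d) 0

  */-cancel : ∀ q d → .{{_ : NonZero d}} →
              (ℤ.+ d ℚ./ 1) ℚ.* q ℚ.* (ℤ.+ 1 ℚ./ d) ≡ q
  */-cancel q d = begin
    N ℚ.* q ℚ.* N⁻¹    ≡⟨ cong (ℚ._* N⁻¹) (ℚ.*-comm N q) ⟩
    q ℚ.* N ℚ.* N⁻¹    ≡⟨ ℚ.*-assoc q N N⁻¹ ⟩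
    q ℚ.* (N ℚ.* N⁻¹)  ≡⟨ cong (q ℚ.*_) (n*1/n d) ⟩
    q ℚ.* 1ℚ           ≡⟨ ℚ.*-identityʳ q ⟩
    q                  ∎
    where
    open ≡-Reasoning
    N = ℤ.+ d ℚ./ 1
    N⁻¹ = ℤ.+ 1 ℚ./ d

  module R where
    open CommutativeRing ℝ-commutativeRing public
    open Algebra.Properties.Ring ring public

  open import Relation.Binary.Reasoning.Setoid R.setoid

⊘-⊛ : ∀ f g → g 0 ≈ 1# → f ⊘ g ⊛ g ≋ f
⊘-⊛ f g g₀≈1 zero = begin
  f 0 * g 0 + 0#  ≈⟨ R.+-identityʳ _ ⟩
  f 0 * g 0       ≈⟨ R.*-congˡ g₀≈1 ⟩
  f 0 * 1#        ≈⟨ R.*-identityʳ _ ⟩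
  f 0             ∎
⊘-⊛ f g g₀≈1 (suc n) = begin
  c + ((λ i → tail f i - f 0 * tail g i) ⊘ g ⊛ g) n
    ≈⟨ R.+-congˡ {c} (⊘-⊛ (λ i → tail f i - f 0 * tail g i) g g₀≈1 n) ⟩
  c + (f (suc n) - c)    ≈⟨ R.+-comm c (f (suc n) - c) ⟩
  (f (suc n) - c) + c    ≈⟨ R.+-assoc (f (suc n)) (- c) c ⟩
  f (suc n) + (- c + c)  ≈⟨ R.+-congˡ {f (suc n)} (R.-‿inverseˡ c) ⟩
  f (suc n) + 0#         ≈⟨ R.+-identityʳ (f (suc n)) ⟩
  f (suc n)              ∎
  where c = f 0 * g (suc n)

private
  ⊛-congˡ : ∀ {f g} h → (∀ n → f n ≈ g n) → f ⊛ h ≋ g ⊛ h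
  ⊛-congˡ h f≈g n =
    sum-cong-≋ {suc n} λ i → R.*-congʳ {h (n ∸ toℕ i)} (f≈g (toℕ i))

  expm1₀ : expm1 0 ≈ 0#
  expm1₀ = ≗⇒≈ λ _ → refl

  expm1₁ : tail expm1 0 ≈ 1#
  expm1₁ = ≗⇒≈ λ _ → refl

  ⊛-suc : ∀ f g → g 0 ≈ 0# → ∀ n → (f ⊛ g) (suc n) ≈ (f ⊛ tail g) n
  ⊛-suc f g g₀≈0 zero = begin
    f 0 * g 1 + (f 1 * g 0 + 0#)
      ≈⟨ R.+-congˡ {f 0 * g 1} (R.trans (R.+-identityʳ _)
           (R.trans (R.*-congˡ {f 1} g₀≈0) (R.zeroʳ (f 1)))) ⟩
    f 0 * g 1 + 0#  ∎
  ⊛-suc f g g₀≈0 (suc n) =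
    R.+-congˡ {f 0 * g (suc (suc n))} (⊛-suc (tail f) g g₀≈0 n)

egf : (ℕ → ℝ) → Series
egf u n = (u n / n !) {{n !≢0}}

-- The defining identity, with the denominator multiplied out.
bernoulli-egf : ∀ t → egf (λ n → bernoulli n t) ⊛ expm1 ≋ z· exp t
bernoulli-egf t n = R.trans (⊛-congˡ expm1 unfold n) (helper n)
  where
  b = bernoulliSeries t

  unfold : ∀ n → egf (λ n → bernoulli n t) n ≈ b n
  unfold n = ≗⇒≈ λ i → */-cancel (seq (b n) i) (n !) {{n !≢0}}

  helper : b ⊛ expm1 ≋ z· exp t
  helper zero = begin
    b 0 * expm1 0 + 0#  ≈⟨ R.+-identityʳ _ ⟩
    b 0 * expm1 0       ≈⟨ R.*-congˡ {b 0} expm1₀ ⟩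
    b 0 * 0#            ≈⟨ R.zeroʳ (b 0) ⟩
    0#                  ∎
  helper (suc n) = begin
    (b ⊛ expm1) (suc n)   ≈⟨ ⊛-suc b expm1 expm1₀ n ⟩
    (b ⊛ tail expm1) n    ≈⟨ ⊘-⊛ (exp t) (tail expm1) expm1₁ n ⟩
    exp t n               ∎

noncentralWhitney : (m : ℕ) → .{{NonZero m}} → ℝ → ℕ → ℕ → ℝ
noncentralWhitney m a n k =
  (1# / (m ℕ.^ k ℕ.* k !)) {{m^i*j≢0 m k (k !) {{it}} {{k !≢0}}}} *
  ∑[ i ≤ k ] (let j = toℕ i in
    fromℕ (k C j) * (- 1#) ^ (k ∸ j) * (fromℕ (m ℕ.* j) - a) ^ n)

{-# OPTIONS --safe #-}

-- With ∇ the negated forward difference, ∇ u = u 0 - u 1, and x j = -a/m + j,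
-- the k-th summand on the right is ∇ᵏ(xⁿ) / (k+1), so the right-hand side is
-- β(xⁿ) for the linear functional β = Σ ∇ᵏ / (k+1).  By the binomial theorem the
-- product of the series Σ β(xⁱ) zⁱ/i! with (e^z - 1)/z has n-th coefficient
-- β(Δ xⁿ⁺¹) / (n+1)! = -Σ ∇ᵏ⁺¹ xⁿ⁺¹ / (k+1) / (n+1)!, a truncated log(1 + Δ) = D
-- applied to xⁿ⁺¹/(n+1)!.  The Leibniz rule for ∇ᵏ shows by induction that it is
-- exactly (x 0)ⁿ / n!, which is the recurrence defining the Bernoulli polynomials.
module Submission where

open import Algebra.Bundles using (CommutativeRing)
import Algebra.Properties.CommutativeSemiring.Binomial as Binomial
import Algebra.Properties.CommutativeSemiring.Exp as Exp
import Algebra.Properties.Monoid.Mult as Mult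
import Algebra.Properties.Semiring.Sum as Sum
open import Data.Fin.Base using (Fin; toℕ; zero; suc)
open import Data.Fin.Properties using (toℕ<n)
import Data.Integer.Base as ℤ
import Data.Integer.Properties as ℤ
open import Data.Nat.Base as ℕ using (ℕ; zero; suc; NonZero; _∸_; _!)
open import Data.Nat.Combinatorics
  using (_C_; nCk≡n!/k![n-k]!; k![n∸k]!∣n!; k>n⇒nCk≡0; nCk+nC[k+1]≡[n+1]C[k+1])
open import Data.Nat.DivMod using (m/n*n≡m)
import Data.Nat.Properties as ℕ
open import Data.Nat.Properties using (_!≢0; _!*_!≢0)
import Data.Nat.Solver
open import Data.Rational.Base as ℚ using (0ℚ; 1ℚ)
import Data.Rational.Properties as ℚ
open import Data.Rational.Solver using (module +-*-Solver)
import Data.Rational.Unnormalised.Base as ℚᵘ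
import Data.Rational.Unnormalised.Properties as ℚᵘ
open import Function.Base using (_∘_; it)
open import Relation.Binary.PropositionalEquality
  using (_≡_; refl; sym; trans; cong; cong₂)
open import Defs

open +-*-Solver using (solve; con; _:+_; _:*_; _:-_; :-_; _:=_)

private
  module ℕS = Data.Nat.Solver.+-*-Solver
  module R = CommutativeRing ℝ-commutativeRing

open import Relation.Binary.Reasoning.Setoid R.setoid
open Sum R.semiring using (sum; *-distribˡ-sum; *-distribʳ-sum; ∑-distrib-+; sum-replicate-zero)
open Mult R.+-monoid using (_×_)
open Exp R.commutativeSemiring using (^-distrib-*; ^-congˡ)

-- Natural numbers and division in the reals

infixl 7 _/!_

_/!_ : ℝ → ℕ → ℝ
x /! n = (x / n !) {{n !≢0}}

fromℚᵘ-homo-+ : ∀ p q → ℚ.fromℚᵘ (p ℚᵘ.+ q) ≡ ℚ.fromℚᵘ p ℚ.+ ℚ.fromℚᵘ q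
fromℚᵘ-homo-+ p q = ℚ.toℚᵘ-injective (ℚᵘ.≃-trans (ℚ.toℚᵘ-fromℚᵘ (p ℚᵘ.+ q))
  (ℚᵘ.≃-sym (ℚᵘ.≃-trans (ℚ.toℚᵘ-homo-+ (ℚ.fromℚᵘ p) (ℚ.fromℚᵘ q))
    (ℚᵘ.+-cong (ℚ.toℚᵘ-fromℚᵘ p) (ℚ.toℚᵘ-fromℚᵘ q)))))

fromℚᵘ-homo-* : ∀ p q → ℚ.fromℚᵘ (p ℚᵘ.* q) ≡ ℚ.fromℚᵘ p ℚ.* ℚ.fromℚᵘ q
fromℚᵘ-homo-* p q = ℚ.toℚᵘ-injective (ℚᵘ.≃-trans (ℚ.toℚᵘ-fromℚᵘ (p ℚᵘ.* q))
  (ℚᵘ.≃-sym (ℚᵘ.≃-trans (ℚ.toℚᵘ-homo-* (ℚ.fromℚᵘ p) (ℚ.fromℚᵘ q))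
    (ℚᵘ.*-cong (ℚ.toℚᵘ-fromℚᵘ p) (ℚ.toℚᵘ-fromℚᵘ q)))))

-- Normalised fractions do not compute for variable numerators, so the identity is checked on
-- unnormalised ones, where equality is cross multiplication, and carried over by `fromℚᵘ`.
fromℕ-homo-+ : ∀ m n → fromℕ (m ℕ.+ n) ≈ fromℕ m + fromℕ n
fromℕ-homo-+ m n = ≗⇒≈ λ _ → trans
  (ℚ.fromℚᵘ-cong {ℚᵘ.mkℚᵘ (ℤ.+ (m ℕ.+ n)) 0} {ℚᵘ.mkℚᵘ (ℤ.+ m) 0 ℚᵘ.+ ℚᵘ.mkℚᵘ (ℤ.+ n) 0}
    (ℚᵘ.*≡* (cong (ℤ._* ℤ.+ 1)
      (sym (cong₂ ℤ._+_ (ℤ.*-identityʳ (ℤ.+ m)) (ℤ.*-identityʳ (ℤ.+ n)))))))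
  (fromℚᵘ-homo-+ (ℚᵘ.mkℚᵘ (ℤ.+ m) 0) (ℚᵘ.mkℚᵘ (ℤ.+ n) 0))

fromℕ-homo-* : ∀ m n → fromℕ (m ℕ.* n) ≈ fromℕ m * fromℕ n
fromℕ-homo-* m n = ≗⇒≈ λ _ → trans
  (ℚ.fromℚᵘ-cong {ℚᵘ.mkℚᵘ (ℤ.+ (m ℕ.* n)) 0} {ℚᵘ.mkℚᵘ (ℤ.+ m) 0 ℚᵘ.* ℚᵘ.mkℚᵘ (ℤ.+ n) 0}
    (ℚᵘ.*≡* (cong (ℤ._* ℤ.+ 1) (ℤ.pos-* m n))))
  (fromℚᵘ-homo-* (ℚᵘ.mkℚᵘ (ℤ.+ m) 0) (ℚᵘ.mkℚᵘ (ℤ.+ n) 0))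

fromℕ-homo-^ : ∀ m n → fromℕ (m ℕ.^ n) ≈ fromℕ m ^ n
fromℕ-homo-^ m zero    = R.refl
fromℕ-homo-^ m (suc n) =
  R.trans (fromℕ-homo-* m (m ℕ.^ n)) (R.*-congˡ (fromℕ-homo-^ m n))

fromℕ-suc : ∀ n → fromℕ (suc n) ≈ fromℕ n + 1#
fromℕ-suc n = R.trans (fromℕ-homo-+ 1 n) (R.+-comm 1# (fromℕ n))

-- The binomial theorem for semirings writes its coefficients as repeated addition; this turns them
-- into real factors.
×≈fromℕ* : ∀ n x → n × x ≈ fromℕ n * x
×≈fromℕ* zero    x = R.sym (R.zeroˡ x)
×≈fromℕ* (suc n) x = begin
  x + n × x               ≈⟨ R.+-congˡ (×≈fromℕ* n x) ⟩
  x + fromℕ n * x         ≈⟨ ≗⇒≈ (λ s → solve 2 (λ x n → x :+ n :* x := (n :+ con 1ℚ) :* x)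
                               refl (seq x s) (seq (fromℕ n) s)) ⟩
  (fromℕ n + 1#) * x      ≈⟨ R.*-congʳ (fromℕ-suc n) ⟨
  fromℕ (suc n) * x       ∎

recip : (d : ℕ) → .{{NonZero d}} → ℝ
recip d = fromℚ (ℤ.+ 1 ℚ./ d)

fromℕ*recip : ∀ d → .{{_ : NonZero d}} → fromℕ d * recip d ≈ 1#
fromℕ*recip d@(suc d-1) = ≗⇒≈ λ _ → trans
  (sym (fromℚᵘ-homo-* (ℚᵘ.mkℚᵘ (ℤ.+ d) 0) (ℚᵘ.mkℚᵘ (ℤ.+ 1) d-1)))
  (ℚ.fromℚᵘ-cong (ℚᵘ.*-inverseʳ (ℚᵘ.mkℚᵘ (ℤ.+ d) 0)))

/-cong : ∀ {x y} d → .{{_ : NonZero d}} → x ≈ y → x / d ≈ y / d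
/-cong d = R.*-congʳ

*-/-cancel : ∀ x d → .{{_ : NonZero d}} → fromℕ d * (x / d) ≈ x
*-/-cancel x d = begin
  fromℕ d * (x * r)  ≈⟨ ≗⇒≈ (λ s → solve 3 (λ d x r → d :* (x :* r) := x :* (d :* r)) refl
                              (seq (fromℕ d) s) (seq x s) (seq r s)) ⟩
  x * (fromℕ d * r)  ≈⟨ R.*-congˡ (fromℕ*recip d) ⟩
  x * 1#             ≈⟨ R.*-identityʳ x ⟩
  x                  ∎
  where r = recip d

-- Multiplication by `fromℕ d` is invertible. Identities with several denominators are proved below
-- by clearing them through this lemma.
/-unique : ∀ {x y} d → .{{_ : NonZero d}} → fromℕ d * y ≈ x → y ≈ x / d
/-unique {x} {y} d dy≈x = begin
  y                  ≈⟨ R.*-identityʳ y ⟨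
  y * 1#             ≈⟨ R.*-congˡ (fromℕ*recip d) ⟨
  y * (fromℕ d * r)  ≈⟨ ≗⇒≈ (λ s → solve 3 (λ d y r → y :* (d :* r) := (d :* y) :* r) refl
                              (seq (fromℕ d) s) (seq y s) (seq r s)) ⟩
  fromℕ d * y * r    ≈⟨ R.*-congʳ dy≈x ⟩
  x * r              ∎
  where r = recip d

-- Finite sums, quotients of series and the exponential series

∑-last : ∀ n (f : Series) → ∑[ i ≤ suc n ] f (toℕ i) ≈ ∑[ i ≤ n ] f (toℕ i) + f (suc n)
∑-last zero    f = ≗⇒≈ λ s → solve 2 (λ x y → x :+ (y :+ con 0ℚ) := x :+ con 0ℚ :+ y) refl
                               (seq (f 0) s) (seq (f 1) s)
∑-last (suc n) f = R.trans (R.+-congˡ (∑-last n (tail f)))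
  (R.sym (R.+-assoc (f 0) _ _))

∑-stable : ∀ {i n} (f : Series) → i ℕ.≤′ n → (∀ k → i ℕ.< k → f k ≈ 0#) →
           ∑[ k ≤ n ] f (toℕ k) ≈ ∑[ k ≤ i ] f (toℕ k)
∑-stable f ℕ.≤′-refl        f≈0 = R.refl
∑-stable f (ℕ.≤′-step {n} i≤′n) f≈0 = begin
  ∑[ k ≤ suc n ] f (toℕ k)          ≈⟨ ∑-last n f ⟩
  ∑[ k ≤ n ] f (toℕ k) + f (suc n)  ≈⟨ R.+-cong (∑-stable f i≤′n f≈0)
                                         (f≈0 (suc n) (ℕ.s≤s (ℕ.≤′⇒≤ i≤′n))) ⟩
  _ + 0#                            ≈⟨ R.+-identityʳ _ ⟩
  _                                 ∎

-- Converse of `⊘-⊛`: as `g 0` is 1, the constant coefficients of `f` and `h` agree, and the later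
-- ones follow by induction along the long division.
⊘-unique : ∀ f g h → g 0 ≈ 1# → f ⊛ g ≋ h → f ≋ h ⊘ g
⊘-unique f g h g₀≈1 f⊛g≋h n = helper n f h f⊛g≋h
  where
  constant : ∀ f h → f ⊛ g ≋ h → f 0 ≈ h 0
  constant f h f⊛g≋h = begin
    f 0             ≈⟨ R.*-identityʳ (f 0) ⟨
    f 0 * 1#        ≈⟨ R.*-congˡ g₀≈1 ⟨
    f 0 * g 0       ≈⟨ R.+-identityʳ _ ⟨
    f 0 * g 0 + 0#  ≈⟨ f⊛g≋h 0 ⟩
    h 0             ∎

  helper : ∀ n f h → f ⊛ g ≋ h → f n ≈ (h ⊘ g) n
  helper zero    f h f⊛g≋h = constant f h f⊛g≋h
  -- The dividend left for `tail f` is the remainder on which `_⊘_` recurses, hence the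
  -- generalisation over `f` and `h`.
  helper (suc n) f h f⊛g≋h = helper n (tail f) _ λ i → begin
    (tail f ⊛ g) i
      ≈⟨ ≗⇒≈ (λ s → solve 2 (λ a b → b := a :+ b :- a) refl
                 (seq (f 0 * g (suc i)) s) (seq ((tail f ⊛ g) i) s)) ⟩
    (f ⊛ g) (suc i) - f 0 * g (suc i)
      ≈⟨ R.+-cong (f⊛g≋h (suc i)) (R.-‿cong (R.*-congʳ (constant f h f⊛g≋h))) ⟩
    h (suc i) - h 0 * g (suc i)  ∎

nCk*k![n∸k]! : ∀ {n k} → k ℕ.≤ n → (n C k) ℕ.* (k ! ℕ.* (n ∸ k) !) ≡ n !
nCk*k![n∸k]! {n} {k} k≤n = trans
  (cong (ℕ._* (k ! ℕ.* (n ∸ k) !)) (nCk≡n!/k![n-k]! k≤n))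
  (m/n*n≡m {{k !* (n ∸ k) !≢0}} (k![n∸k]!∣n! k≤n))

-- The binomial theorem divided by n!, since C(n,i) / n! = 1 / (i! (n-i)!).
exp-+ : ∀ x y → exp x ⊛ exp y ≋ exp (x + y)
exp-+ x y n = begin
  ∑[ i ≤ n ] (exp x (toℕ i) * exp y (n ∸ toℕ i))
    ≈⟨ sum-cong-≋ {suc n} {y = λ i → binomialTerm x y n i /! n}
         (λ i → term (toℕ i) (ℕ.s≤s⁻¹ (toℕ<n i))) ⟩
  ∑[ i ≤ n ] (binomialTerm x y n i /! n)
    ≈⟨ *-distribʳ-sum {suc n} _ (binomialTerm x y n) ⟨
  (∑[ i ≤ n ] binomialTerm x y n i) /! n
    ≈⟨ R.*-congʳ (Binomial.theorem R.commutativeSemiring n x y) ⟨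
  exp (x + y) n  ∎
  where
  open Binomial R.commutativeSemiring using (binomialTerm)

  term : ∀ i → i ℕ.≤ n →
         exp x i * exp y (n ∸ i) ≈ ((n C i) × (x ^ i * y ^ (n ∸ i))) /! n
  term i i≤n = /-unique (n !) {{n !≢0}} (begin
    fromℕ (n !) * (exp x i * exp y (n ∸ i))
      ≡⟨ cong (λ k → fromℕ k * (exp x i * exp y (n ∸ i))) (nCk*k![n∸k]! i≤n) ⟨
    fromℕ ((n C i) ℕ.* (i ! ℕ.* (n ∸ i) !)) * (exp x i * exp y (n ∸ i))
      ≈⟨ R.*-congʳ (R.trans (fromℕ-homo-* (n C i) (i ! ℕ.* (n ∸ i) !))
           (R.*-congˡ (fromℕ-homo-* (i !) ((n ∸ i) !)))) ⟩
    fromℕ (n C i) * (fromℕ (i !) * fromℕ ((n ∸ i) !)) * (exp x i * exp y (n ∸ i))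
      ≈⟨ ≗⇒≈ (λ s → solve 5 (λ c p q e f → c :* (p :* q) :* (e :* f) := c :* ((p :* e) :* (q :* f)))
                 refl (seq (fromℕ (n C i)) s) (seq (fromℕ (i !)) s) (seq (fromℕ ((n ∸ i) !)) s)
                 (seq (exp x i) s) (seq (exp y (n ∸ i)) s)) ⟩
    fromℕ (n C i) * ((fromℕ (i !) * exp x i) * (fromℕ ((n ∸ i) !) * exp y (n ∸ i)))
      ≈⟨ R.*-congˡ (R.*-cong (*-/-cancel (x ^ i) (i !) {{i !≢0}})
           (*-/-cancel (y ^ (n ∸ i)) ((n ∸ i) !) {{(n ∸ i) !≢0}})) ⟩
    fromℕ (n C i) * (x ^ i * y ^ (n ∸ i))
      ≈⟨ ×≈fromℕ* (n C i) _ ⟨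
    (n C i) × (x ^ i * y ^ (n ∸ i))  ∎)

-- This is e^{xz}(e^z - 1) = e^{(x+1)z} - e^{xz} with a factor z cancelled, which raises the index
-- on the right by one.
exp⊛tail-expm1 : ∀ x n → (exp x ⊛ tail expm1) n ≈ exp (x + 1#) (suc n) - exp x (suc n)
exp⊛tail-expm1 x n = begin
  (exp x ⊛ tail expm1) n
    ≈⟨ sum-cong-≋ {suc n} (λ i → shift (toℕ i) (ℕ.s≤s⁻¹ (toℕ<n i))) ⟩
  S
    ≈⟨ ≗⇒≈ (λ s → solve 2 (λ a b → a := a :+ b :- b) refl (seq S s) (seq (exp x (suc n)) s)) ⟩
  -- `S` is coefficient n+1 of e^{xz} e^z without its term i = n+1, so that term is added and
  -- subtracted.
  S + exp x (suc n) - exp x (suc n)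
    ≈⟨ R.+-congʳ (R.+-congˡ last-term) ⟨
  S + f (suc n) - exp x (suc n)
    ≈⟨ R.+-congʳ (∑-last n f) ⟨
  (exp x ⊛ exp 1#) (suc n) - exp x (suc n)
    ≈⟨ R.+-congʳ (exp-+ x 1# (suc n)) ⟩
  exp (x + 1#) (suc n) - exp x (suc n)  ∎
  where
  f : Series
  f i = exp x i * exp 1# (suc n ∸ i)

  S = ∑[ i ≤ n ] f (toℕ i)

  shift : ∀ i → i ℕ.≤ n → exp x i * tail expm1 (n ∸ i) ≈ f i
  shift i i≤n = begin
    exp x i * (exp 1# (suc (n ∸ i)) - 0#)
      ≈⟨ R.*-congˡ (≗⇒≈ λ s → solve 1 (λ a → a :- con 0ℚ := a) refl (seq (exp 1# (suc (n ∸ i))) s)) ⟩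
    exp x i * exp 1# (suc (n ∸ i))
      ≡⟨ cong (λ k → exp x i * exp 1# k) (ℕ.+-∸-assoc 1 i≤n) ⟨
    f i  ∎

  last-term : f (suc n) ≈ exp x (suc n)
  last-term = begin
    exp x (suc n) * exp 1# (n ∸ n)  ≡⟨ cong (λ k → exp x (suc n) * exp 1# k) (ℕ.n∸n≡0 n) ⟩
    exp x (suc n) * exp 1# 0        ≈⟨ R.*-congˡ (≗⇒≈ λ _ → refl) ⟩
    exp x (suc n) * 1#              ≈⟨ R.*-identityʳ _ ⟩
    exp x (suc n)                   ∎

-- Iterated differences at index 0

∇ : ℕ → Series → ℝ
∇ zero    u = u 0
∇ (suc k) u = ∇ k u - ∇ k (tail u)

∇-binomial : ∀ k u → ∇ k u ≈ ∑[ j ≤ k ] (fromℕ (k C toℕ j) * (- 1#) ^ toℕ j * u (toℕ j))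
∇-binomial zero    u = ≗⇒≈ λ s → solve 1 (λ a → a := con 1ℚ :* con 1ℚ :* a :+ con 0ℚ) refl (seq (u 0) s)
∇-binomial (suc k) u = begin
  ∇ k u - ∇ k (tail u)
    ≈⟨ R.+-cong (∇-binomial k u) (R.-‿cong (∇-binomial k (tail u))) ⟩
  ∑[ j ≤ k ] t k u (toℕ j) - ∑[ j ≤ k ] t k (tail u) (toℕ j)
    ≈⟨ R.+-congʳ extend ⟩
  ∑[ j ≤ suc k ] t k u (toℕ j) - ∑[ j ≤ k ] t k (tail u) (toℕ j)
    ≈⟨ R.+-congʳ (R.+-congˡ (R.trans (sum-cong-≋ {suc k} (λ j → pascal (toℕ j)))
         (∑-distrib-+ {suc k} (λ j → t (suc k) u (suc (toℕ j))) (λ j → t k (tail u) (toℕ j))))) ⟩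
  t k u 0 + (A + B) - B
    ≈⟨ ≗⇒≈ (λ s → solve 3 (λ c a b → c :+ (a :+ b) :- b := c :+ a) refl
                (seq (t k u 0) s) (seq A s) (seq B s)) ⟩
  ∑[ j ≤ suc k ] t (suc k) u (toℕ j)  ∎
  where
  t : ℕ → Series → Series
  t k u j = fromℕ (k C j) * (- 1#) ^ j * u j

  A = ∑[ j ≤ k ] t (suc k) u (suc (toℕ j))
  B = ∑[ j ≤ k ] t k (tail u) (toℕ j)

  -- The added term contains C(k,k+1) = 0; with it, the first sum has a term at j+1 for every j ≤ k,
  -- to be matched with term j of the second.
  extend : ∑[ j ≤ k ] t k u (toℕ j) ≈ ∑[ j ≤ suc k ] t k u (toℕ j)
  extend = R.sym (∑-stable (t k u) (ℕ.≤′-step ℕ.≤′-refl) λ j k<j → begin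
    fromℕ (k C j) * (- 1#) ^ j * u j
      ≡⟨ cong (λ c → fromℕ c * (- 1#) ^ j * u j) (k>n⇒nCk≡0 k<j) ⟩
    fromℕ 0 * (- 1#) ^ j * u j
      ≈⟨ ≗⇒≈ (λ s → solve 2 (λ a b → con 0ℚ :* a :* b := con 0ℚ) refl (seq ((- 1#) ^ j) s) (seq (u j) s)) ⟩
    0#  ∎)

  -- Raising j flips the sign, so Pascal's rule appears as C(k,j+1) = C(k+1,j+1) - C(k,j).
  pascal : ∀ j → t k u (suc j) ≈ t (suc k) u (suc j) + t k (tail u) j
  pascal j = begin
    t k u (suc j)
      ≈⟨ ≗⇒≈ (λ s → solve 4 (λ c d e v → d :* (:- con 1ℚ :* e) :* v
                              := (c :+ d) :* (:- con 1ℚ :* e) :* v :+ c :* e :* v) refl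
             (seq (fromℕ (k C j)) s) (seq (fromℕ (k C suc j)) s) (seq ((- 1#) ^ j) s) (seq (u (suc j)) s)) ⟩
    (fromℕ (k C j) + fromℕ (k C suc j)) * (- 1#) ^ suc j * u (suc j) + t k (tail u) j
      ≈⟨ R.+-congʳ (R.*-congʳ (R.*-congʳ (fromℕ-homo-+ (k C j) (k C suc j)))) ⟨
    fromℕ (k C j ℕ.+ k C suc j) * (- 1#) ^ suc j * u (suc j) + t k (tail u) j
      ≡⟨ cong (λ c → fromℕ c * (- 1#) ^ suc j * u (suc j) + t k (tail u) j)
              (nCk+nC[k+1]≡[n+1]C[k+1] k j) ⟩
    t (suc k) u (suc j) + t k (tail u) j  ∎

-- Only two terms of the Leibniz rule survive: the first difference of `x` is constant and its
-- higher ones vanish. The progression is an argument because the induction also needs `tail x`.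
∇-leibniz : ∀ k x u → (∀ j → x (suc j) ≈ x j + 1#) →
            ∇ (suc k) (λ j → x j * u j) ≈ x 0 * ∇ (suc k) u - fromℕ (suc k) * ∇ k (tail u)
∇-leibniz zero x u x-step = begin
  x 0 * u 0 - x 1 * u 1
    ≈⟨ R.+-congˡ (R.-‿cong (R.*-congʳ (x-step 0))) ⟩
  x 0 * u 0 - (x 0 + 1#) * u 1
    ≈⟨ ≗⇒≈ (λ s → solve 3 (λ x u v → x :* u :- (x :+ con 1ℚ) :* v := x :* (u :- v) :- con 1ℚ :* v) refl
              (seq (x 0) s) (seq (u 0) s) (seq (u 1) s)) ⟩
  x 0 * (u 0 - u 1) - fromℕ 1 * u 1  ∎
∇-leibniz (suc k) x u x-step = begin
  ∇ (suc k) (λ j → x j * u j) - ∇ (suc k) (λ j → tail x j * tail u j)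
    ≈⟨ R.+-cong (∇-leibniz k x u x-step)
         (R.-‿cong (∇-leibniz k (tail x) (tail u) (x-step ∘ suc))) ⟩
  (x 0 * ∇ (suc k) u - fromℕ (suc k) * Q) - (x 1 * (Q - Q′) - fromℕ (suc k) * Q′)
    ≈⟨ R.+-congˡ (R.-‿cong (R.+-congʳ (R.*-congʳ (x-step 0)))) ⟩
  (x 0 * ∇ (suc k) u - fromℕ (suc k) * Q) - ((x 0 + 1#) * (Q - Q′) - fromℕ (suc k) * Q′)
    ≈⟨ ≗⇒≈ (λ s → solve 5 (λ x p k q q′ →
                  (x :* p :- k :* q) :- ((x :+ con 1ℚ) :* (q :- q′) :- k :* q′)
                  := x :* (p :- (q :- q′)) :- (k :+ con 1ℚ) :* (q :- q′)) refl
              (seq (x 0) s) (seq (∇ (suc k) u) s) (seq (fromℕ (suc k)) s) (seq Q s) (seq Q′ s)) ⟩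
  x 0 * ∇ (suc (suc k)) u - (fromℕ (suc k) + 1#) * ∇ (suc k) (tail u)
    ≈⟨ R.+-congˡ (R.-‿cong (R.*-congʳ (fromℕ-suc (suc k)))) ⟨
  x 0 * ∇ (suc (suc k)) u - fromℕ (suc (suc k)) * ∇ (suc k) (tail u)  ∎
  where
  Q  = ∇ k (tail u)
  Q′ = ∇ k (tail (tail u))

-- Each difference lowers the degree of a polynomial; formally, `∇-leibniz` reduces degree n+1 to
-- degree n. This is what makes the truncated operator series below exact on powers.
∇-power-vanishes : ∀ {k n} x → (∀ j → x (suc j) ≈ x j + 1#) → n ℕ.< k → ∇ k (λ j → x j ^ n) ≈ 0#
∇-power-vanishes {suc k} {zero}  x x-step _ = R.-‿inverseʳ (∇ k (λ _ → 1#))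
∇-power-vanishes {suc k} {suc n} x x-step (ℕ.s≤s n<k) = begin
  ∇ (suc k) (λ j → x j * x j ^ n)
    ≈⟨ ∇-leibniz k x (λ j → x j ^ n) x-step ⟩
  x 0 * ∇ (suc k) (λ j → x j ^ n) - fromℕ (suc k) * ∇ k (λ j → tail x j ^ n)
    ≈⟨ R.+-cong (R.*-congˡ (∇-power-vanishes x x-step (ℕ.m≤n⇒m≤1+n n<k)))
         (R.-‿cong (R.*-congˡ (∇-power-vanishes (tail x) (x-step ∘ suc) n<k))) ⟩
  x 0 * 0# - fromℕ (suc k) * 0#
    ≈⟨ ≗⇒≈ (λ s → solve 2 (λ a b → a :* con 0ℚ :- b :* con 0ℚ := con 0ℚ) refl
              (seq (x 0) s) (seq (fromℕ (suc k)) s)) ⟩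
  0#  ∎

-- Linear functionals on sequences and the truncated operator series

-- Linearity lets `β` pass through the coefficients of a Cauchy product. Scalars stand on the right,
-- where reciprocals and the coefficients of `tail expm1` occur.
record IsLinear (φ : Series → ℝ) : Set where
  field
    ≋-cong : ∀ {u v} → u ≋ v → φ u ≈ φ v
    homo-+ : ∀ u v → φ (λ j → u j + v j) ≈ φ u + φ v
    homo-* : ∀ u c → φ (λ j → u j * c) ≈ φ u * c

  homo-0 : φ (λ _ → 0#) ≈ 0#
  homo-0 = begin
    φ (λ _ → 0#)       ≈⟨ ≋-cong (λ _ → R.zeroʳ 0#) ⟨
    φ (λ _ → 0# * 0#)  ≈⟨ homo-* (λ _ → 0#) 0# ⟩
    φ (λ _ → 0#) * 0#  ≈⟨ R.zeroʳ _ ⟩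
    0#                 ∎

  homo-sum : ∀ {n} (u : Fin n → Series) → φ (λ j → sum (λ i → u i j)) ≈ sum (λ i → φ (u i))
  homo-sum {zero}  u = homo-0
  homo-sum {suc n} u = R.trans (homo-+ (u zero) (λ j → sum (λ i → u (suc i) j)))
    (R.+-congˡ (homo-sum (u ∘ suc)))

open IsLinear

∇-isLinear : ∀ k → IsLinear (∇ k)
∇-isLinear zero = record
  { ≋-cong = λ u≋v → u≋v 0
  ; homo-+ = λ _ _ → R.refl
  ; homo-* = λ _ _ → R.refl
  }
∇-isLinear (suc k) = record
  { ≋-cong = λ u≋v → R.+-cong (≋-cong ih u≋v) (R.-‿cong (≋-cong ih (u≋v ∘ suc)))
  ; homo-+ = λ u v → R.trans
      (R.+-cong (homo-+ ih u v) (R.-‿cong (homo-+ ih (tail u) (tail v))))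
      (≗⇒≈ λ s → solve 4 (λ a b c d → (a :+ b) :- (c :+ d) := (a :- c) :+ (b :- d)) refl
        (seq (∇ k u) s) (seq (∇ k v) s) (seq (∇ k (tail u)) s) (seq (∇ k (tail v)) s))
  ; homo-* = λ u c → R.trans
      (R.+-cong (homo-* ih u c) (R.-‿cong (homo-* ih (tail u) c)))
      (≗⇒≈ λ s → solve 3 (λ a b c → a :* c :- b :* c := (a :- b) :* c) refl
        (seq (∇ k u) s) (seq (∇ k (tail u)) s) (seq c s))
  }
  where ih = ∇-isLinear k

∇-Δ : ∀ k u → ∇ k (λ j → u (suc j) - u j) ≈ - ∇ (suc k) u
∇-Δ k u = begin
  ∇ k (λ j → u (suc j) - u j)
    ≈⟨ ≋-cong L (λ j → ≗⇒≈ λ s → solve 2 (λ a b → a :- b := a :+ b :* (:- con 1ℚ)) refl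
                       (seq (u (suc j)) s) (seq (u j) s)) ⟩
  ∇ k (λ j → u (suc j) + u j * (- 1#))
    ≈⟨ R.trans (homo-+ L (tail u) (λ j → u j * (- 1#))) (R.+-congˡ (homo-* L u (- 1#))) ⟩
  ∇ k (tail u) + ∇ k u * (- 1#)
    ≈⟨ ≗⇒≈ (λ s → solve 2 (λ a b → a :+ b :* (:- con 1ℚ) := :- (b :- a)) refl
              (seq (∇ k (tail u)) s) (seq (∇ k u) s)) ⟩
  - ∇ (suc k) u  ∎
  where L = ∇-isLinear k

-- Since ∇ = −Δ, the full series Λ is −log(1 + Δ) = −D, and β is D / (e^D − 1).
Λ β : ℕ → Series → ℝ
Λ N u = ∑[ k ≤ N ] (∇ (suc (toℕ k)) u / suc (toℕ k))
β N u = ∑[ k ≤ N ] (∇ (toℕ k) u / suc (toℕ k))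

β-isLinear : ∀ N → IsLinear (β N)
β-isLinear N = record
  { ≋-cong = λ u≋v → sum-cong-≋ {suc N} λ k →
      /-cong (suc (toℕ k)) (≋-cong (∇-isLinear (toℕ k)) u≋v)
  ; homo-+ = λ u v → R.trans
      (sum-cong-≋ {suc N} {y = λ k → term u k + term v k} λ k → R.trans
        (/-cong (suc (toℕ k)) (homo-+ (∇-isLinear (toℕ k)) u v))
        (R.distribʳ (recip (suc (toℕ k))) (∇ (toℕ k) u) (∇ (toℕ k) v)))
      (∑-distrib-+ {suc N} (term u) (term v))
  ; homo-* = λ u c → R.trans
      (sum-cong-≋ {suc N} {y = λ k → term u k * c} λ k → R.trans
        (/-cong (suc (toℕ k)) (homo-* (∇-isLinear (toℕ k)) u c))
        (≗⇒≈ λ s → solve 3 (λ a b c → a :* b :* c := a :* c :* b) refl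
          (seq (∇ (toℕ k) u) s) (seq c s) (seq (recip (suc (toℕ k))) s)))
      (R.sym (*-distribʳ-sum {suc N} c (term u)))
  }
  where
  term : Series → Fin (suc N) → ℝ
  term u k = ∇ (toℕ k) u / suc (toℕ k)

-- Formally, D / (e^D - 1) applied after e^D - 1 is D; the truncations already agree term by term,
-- by `∇-Δ`.
β-Δ : ∀ N u → β N (λ j → u (suc j) - u j) ≈ Λ N u * (- 1#)
β-Δ N u = R.trans
  (sum-cong-≋ {suc N} {y = λ k → term k * (- 1#)} λ k → R.trans
    (/-cong (suc (toℕ k)) (∇-Δ (toℕ k) u))
    (≗⇒≈ λ s → solve 2 (λ a b → :- a :* b := a :* b :* (:- con 1ℚ)) refl
      (seq (∇ (suc (toℕ k)) u) s) (seq (recip (suc (toℕ k))) s)))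
  (R.sym (*-distribʳ-sum {suc N} (- 1#) term))
  where
  term : Fin (suc N) → ℝ
  term k = ∇ (suc (toℕ k)) u / suc (toℕ k)

-- The truncated series on powers of an arithmetic progression

module _ (x : Series) (x-step : ∀ j → x (suc j) ≈ x j + 1#) where

  -- The product rule D(xu) = x Du + u for -D, where truncation leaves the error `∇ (suc N) u`.
  Λ-leibniz : ∀ N u → Λ N (λ j → x j * u j) ≈ x 0 * Λ N u - (u 0 - ∇ (suc N) u)
  Λ-leibniz zero u = begin
    (∇ 1 (λ j → x j * u j) / 1) + 0#
      ≈⟨ R.+-congʳ (R.*-congʳ (∇-leibniz 0 x u x-step)) ⟩
    (x 0 * ∇ 1 u - 1# * u 1) / 1 + 0#
      ≈⟨ ≗⇒≈ (λ s → solve 3 (λ x u v → (x :* (u :- v) :- con 1ℚ :* v) :* con 1ℚ :+ con 0ℚ :=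
                        x :* ((u :- v) :* con 1ℚ :+ con 0ℚ) :- (u :- (u :- v))) refl
                (seq (x 0) s) (seq (u 0) s) (seq (u 1) s)) ⟩
    x 0 * Λ 0 u - (u 0 - ∇ 1 u)  ∎
  Λ-leibniz (suc N) u = begin
    Λ (suc N) (λ j → x j * u j)
      ≈⟨ ∑-last N (λ k → ∇ (suc k) (λ j → x j * u j) / suc k) ⟩
    Λ N (λ j → x j * u j) + ∇ (2 ℕ.+ N) (λ j → x j * u j) / (2 ℕ.+ N)
      ≈⟨ R.+-cong (Λ-leibniz N u) (R.*-congʳ (∇-leibniz (suc N) x u x-step)) ⟩
    (x 0 * Λ N u - (u 0 - P)) + (x 0 * (P - Q) - fromℕ (2 ℕ.+ N) * Q) * r
      ≈⟨ ≗⇒≈ (λ s → solve 7 (λ x l u p q d r →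
              (x :* l :- (u :- p)) :+ (x :* (p :- q) :- d :* q) :* r :=
              x :* (l :+ (p :- q) :* r) :- (u :- (p :- (d :* r) :* q))) refl
            (seq (x 0) s) (seq (Λ N u) s) (seq (u 0) s) (seq P s) (seq Q s)
            (seq (fromℕ (2 ℕ.+ N)) s) (seq r s)) ⟩
    -- The factor N+2 from `∇-leibniz` cancels the divisor of the new summand, and the error becomes
    -- `P - Q`, which is `∇ (2 ℕ.+ N) u`.
    x 0 * (Λ N u + (P - Q) * r) - (u 0 - (P - (fromℕ (2 ℕ.+ N) * r) * Q))
      ≈⟨ R.+-cong (R.*-congˡ (R.sym (∑-last N (λ k → ∇ (suc k) u / suc k))))
           (R.-‿cong (R.+-congˡ (R.-‿cong (R.+-congˡ (R.-‿cong
             (R.trans (R.*-congʳ (fromℕ*recip (2 ℕ.+ N))) (R.*-identityˡ Q))))))) ⟩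
    x 0 * Λ (suc N) u - (u 0 - ∇ (2 ℕ.+ N) u)  ∎
    where
    P = ∇ (suc N) u
    Q = ∇ (suc N) (tail u)
    r = recip (2 ℕ.+ N)

  -- The power rule for derivatives. It is exact because the truncation error is a difference of
  -- order N+1 of a power of degree n ≤ N.
  Λ-power : ∀ {N} n → n ℕ.≤ N → Λ N (λ j → x j ^ suc n) ≈ - (fromℕ (suc n) * x 0 ^ n)
  Λ-power {N} n n≤N = begin
    Λ N (λ j → x j * x j ^ n)
      ≈⟨ Λ-leibniz N (λ j → x j ^ n) ⟩
    x 0 * Λ N (λ j → x j ^ n) - (x 0 ^ n - ∇ (suc N) (λ j → x j ^ n))
      ≈⟨ R.+-cong (previous n n≤N)
           (R.-‿cong (R.+-congˡ (R.-‿cong (∇-power-vanishes x x-step (ℕ.s≤s n≤N))))) ⟩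
    - (fromℕ n * x 0 ^ n) - (x 0 ^ n - 0#)
      ≈⟨ ≗⇒≈ (λ s → solve 2 (λ n p → :- (n :* p) :- (p :- con 0ℚ) := :- ((n :+ con 1ℚ) :* p)) refl
                (seq (fromℕ n) s) (seq (x 0 ^ n) s)) ⟩
    - ((fromℕ n + 1#) * x 0 ^ n)
      ≈⟨ R.-‿cong (R.*-congʳ (fromℕ-suc n)) ⟨
    - (fromℕ (suc n) * x 0 ^ n)  ∎
    where
    -- The factor `x 0` keeps the exponent at n, so n = 0 fits the same formula without an exponent
    -- n-1.
    previous : ∀ n → n ℕ.≤ N → x 0 * Λ N (λ j → x j ^ n) ≈ - (fromℕ n * x 0 ^ n)
    previous zero _ = begin
      x 0 * Λ N (λ _ → 1#)
        ≈⟨ R.*-congˡ (R.trans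
             (sum-cong-≋ {suc N} {y = λ _ → 0#} λ k → R.trans
               (/-cong (suc (toℕ k)) (∇-power-vanishes {suc (toℕ k)} {0} x x-step (ℕ.s≤s ℕ.z≤n)))
               (R.zeroˡ (recip (suc (toℕ k)))))
             (sum-replicate-zero (suc N))) ⟩
      x 0 * 0#
        ≈⟨ ≗⇒≈ (λ s → solve 1 (λ a → a :* con 0ℚ := :- (con 0ℚ :* con 1ℚ)) refl (seq (x 0) s)) ⟩
      - (fromℕ 0 * 1#)  ∎
    previous (suc n) n<N = begin
      x 0 * Λ N (λ j → x j ^ suc n)
        ≈⟨ R.*-congˡ (Λ-power n (ℕ.<⇒≤ n<N)) ⟩
      x 0 * (- (fromℕ (suc n) * x 0 ^ n))
        ≈⟨ ≗⇒≈ (λ s → solve 3 (λ x d p → x :* (:- (d :* p)) := :- (d :* (x :* p))) refl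
                  (seq (x 0) s) (seq (fromℕ (suc n)) s) (seq (x 0 ^ n) s)) ⟩
      - (fromℕ (suc n) * x 0 ^ suc n)  ∎

  -- Gives all terms of a Cauchy product the same functional `β n`, so that it can be taken out of
  -- the sum.
  β-power-stable : ∀ {i n} → i ℕ.≤ n → β n (λ j → x j ^ i) ≈ β i (λ j → x j ^ i)
  β-power-stable {i} i≤n = ∑-stable (λ k → ∇ k (λ j → x j ^ i) / suc k) (ℕ.≤⇒≤′ i≤n)
    λ k i<k → R.trans (R.*-congʳ (∇-power-vanishes x x-step i<k)) (R.zeroˡ _)

  -- The signs from `β-Δ` and `Λ-power` cancel, and (n+1) / (n+1)! = 1 / n!.
  β-Δexp : ∀ n → β n (λ j → exp (x j + 1#) (suc n) - exp (x j) (suc n)) ≈ exp (x 0) n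
  β-Δexp n = begin
    β n (λ j → exp (x j + 1#) (suc n) - exp (x j) (suc n))
      ≈⟨ ≋-cong (β-isLinear n) (λ j → R.trans
           (R.+-congʳ (R.*-congʳ (^-congˡ (suc n) (R.sym (x-step j)))))
           (≗⇒≈ λ s → solve 3 (λ a b c → a :* c :- b :* c := (a :- b) :* c) refl
             (seq (x (suc j) ^ suc n) s) (seq (x j ^ suc n) s) (seq r s))) ⟩
    β n (λ j → (x (suc j) ^ suc n - x j ^ suc n) /! suc n)
      ≈⟨ homo-* (β-isLinear n) (λ j → x (suc j) ^ suc n - x j ^ suc n) _ ⟩
    β n (λ j → x (suc j) ^ suc n - x j ^ suc n) /! suc n
      ≈⟨ R.*-congʳ (R.trans (β-Δ n (λ j → x j ^ suc n)) (R.*-congʳ (Λ-power n ℕ.≤-refl))) ⟩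
    (- (fromℕ (suc n) * x 0 ^ n) * (- 1#)) /! suc n
      ≈⟨ /-unique (n !) {{n !≢0}} (begin
           fromℕ (n !) * (- (fromℕ (suc n) * p) * (- 1#) * r)
             ≈⟨ ≗⇒≈ (λ s → solve 4 (λ f d p r → f :* (:- (d :* p) :* (:- con 1ℚ) :* r)
                                       := d :* f :* r :* p) refl
                  (seq (fromℕ (n !)) s) (seq (fromℕ (suc n)) s) (seq p s) (seq r s)) ⟩
           fromℕ (suc n) * fromℕ (n !) * r * p
             ≈⟨ R.*-congʳ (R.*-congʳ (fromℕ-homo-* (suc n) (n !))) ⟨
           fromℕ (suc n !) * r * p
             ≈⟨ R.*-congʳ (fromℕ*recip (suc n !) {{suc n !≢0}}) ⟩
           1# * p
             ≈⟨ R.*-identityˡ p ⟩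
           p  ∎) ⟩
    exp (x 0) n  ∎
    where
    p = x 0 ^ n
    r = recip (suc n !) {{suc n !≢0}}

  egf-β : egf (λ i → β i (λ j → x j ^ i)) ⊛ tail expm1 ≋ exp (x 0)
  egf-β n = begin
    ∑[ i ≤ n ] (β (toℕ i) (λ j → x j ^ toℕ i) /! toℕ i * g (n ∸ toℕ i))
      ≈⟨ sum-cong-≋ {suc n} (λ i → term (toℕ i) (ℕ.s≤s⁻¹ (toℕ<n i))) ⟩
    ∑[ i ≤ n ] (β n (λ j → exp (x j) (toℕ i) * g (n ∸ toℕ i)))
      ≈⟨ homo-sum L {suc n} (λ i j → exp (x j) (toℕ i) * g (n ∸ toℕ i)) ⟨
    β n (λ j → (exp (x j) ⊛ g) n)
      ≈⟨ ≋-cong L (λ j → exp⊛tail-expm1 (x j) n) ⟩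
    β n (λ j → exp (x j + 1#) (suc n) - exp (x j) (suc n))
      ≈⟨ β-Δexp n ⟩
    exp (x 0) n  ∎
    where
    g = tail expm1
    L = β-isLinear n

    term : ∀ i → i ℕ.≤ n → β i (λ j → x j ^ i) /! i * g (n ∸ i) ≈
                           β n (λ j → exp (x j) i * g (n ∸ i))
    term i i≤n = begin
      β i (λ j → x j ^ i) /! i * g (n ∸ i)
        ≈⟨ R.*-congʳ (R.*-congʳ (β-power-stable i≤n)) ⟨
      β n (λ j → x j ^ i) /! i * g (n ∸ i)
        ≈⟨ R.*-congʳ (homo-* L (λ j → x j ^ i) (recip (i !) {{i !≢0}})) ⟨
      β n (λ j → exp (x j) i) * g (n ∸ i)
        ≈⟨ homo-* L (λ j → exp (x j) i) (g (n ∸ i)) ⟨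
      β n (λ j → exp (x j) i * g (n ∸ i))  ∎

-- By `egf-β` the generating series of the right-hand side solves the division problem defining
-- `bernoulliSeries`, and the quotient is unique.
bernoulli≈β : ∀ t n → bernoulli n t ≈ β n (λ j → (t + fromℕ j) ^ n)
bernoulli≈β t n = begin
  fromℕ (n !) * (exp t ⊘ tail expm1) n
    ≈⟨ R.*-congˡ (⊘-unique (egf (λ i → β i (λ j → x j ^ i))) (tail expm1) (exp t) (≗⇒≈ λ _ → refl)
         (λ k → R.trans (egf-β x x-step k) (R.*-congʳ (^-congˡ k (R.+-identityʳ t)))) n) ⟨
  fromℕ (n !) * (β n (λ j → x j ^ n) /! n)
    ≈⟨ *-/-cancel _ (n !) {{n !≢0}} ⟩
  β n (λ j → x j ^ n)  ∎
  where
  x : Series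
  x j = t + fromℕ j

  x-step : ∀ j → x (suc j) ≈ x j + 1#
  x-step j = R.trans (R.+-congˡ (fromℕ-suc j)) (R.sym (R.+-assoc t (fromℕ j) 1#))

-- Whitney numbers as differences of powers

-- Reconciles the sign (-1)^{k-j} of the Whitney sum with the sign (-1)^j in `∇-binomial`.
-1^-cancel : ∀ {j k} → j ℕ.≤ k → (- 1#) ^ k * (- 1#) ^ (k ∸ j) ≈ (- 1#) ^ j
-1^-cancel {k = zero} ℕ.z≤n = R.*-identityʳ 1#
-1^-cancel {k = suc k} ℕ.z≤n = begin
  - 1# * (- 1#) ^ k * (- 1# * (- 1#) ^ k)
    ≈⟨ ≗⇒≈ (λ s → solve 1 (λ e → :- con 1ℚ :* e :* (:- con 1ℚ :* e) := e :* e) refl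
              (seq ((- 1#) ^ k) s)) ⟩
  (- 1#) ^ k * (- 1#) ^ k
    ≈⟨ -1^-cancel {0} {k} ℕ.z≤n ⟩
  1#  ∎
-1^-cancel (ℕ.s≤s {j} {k} j≤k) = R.trans
  (R.*-assoc (- 1#) ((- 1#) ^ k) ((- 1#) ^ (k ∸ j))) (R.*-congˡ (-1^-cancel j≤k))

module _ (a : ℝ) (m : ℕ) .{{_ : NonZero m}} where

  x : Series
  x j = (- a) / m + fromℕ j

  m*x : ∀ j → fromℕ (m ℕ.* j) - a ≈ fromℕ m * x j
  m*x j = begin
    fromℕ (m ℕ.* j) - a
      ≈⟨ R.+-cong (fromℕ-homo-* m j) (R.sym (*-/-cancel (- a) m)) ⟩
    fromℕ m * fromℕ j + fromℕ m * ((- a) / m)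
      ≈⟨ R.trans (R.+-comm _ _) (R.sym (R.distribˡ (fromℕ m) _ _)) ⟩
    fromℕ m * x j  ∎

  whitneySum : ℕ → ℕ → ℝ
  whitneySum n k = ∑[ i ≤ k ] (let j = toℕ i in
    fromℕ (k C j) * (- 1#) ^ (k ∸ j) * (fromℕ (m ℕ.* j) - a) ^ n)

  -- Taking m out of each node mj - a leaves a progression of step 1; the n-th powers contribute the
  -- common factor mⁿ.
  whitneySum≈∇ : ∀ n k → (- 1#) ^ k * whitneySum n k ≈ fromℕ (m ℕ.^ n) * ∇ k (λ j → x j ^ n)
  whitneySum≈∇ n k = begin
    (- 1#) ^ k * whitneySum n k
      ≈⟨ *-distribˡ-sum {suc k} ((- 1#) ^ k) (f ∘ toℕ) ⟩
    ∑[ i ≤ k ] ((- 1#) ^ k * f (toℕ i))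
      ≈⟨ sum-cong-≋ {suc k} {y = λ i → fromℕ (m ℕ.^ n) * g (toℕ i)}
           (λ i → term (toℕ i) (ℕ.s≤s⁻¹ (toℕ<n i))) ⟩
    ∑[ i ≤ k ] (fromℕ (m ℕ.^ n) * g (toℕ i))
      ≈⟨ *-distribˡ-sum {suc k} (fromℕ (m ℕ.^ n)) (g ∘ toℕ) ⟨
    fromℕ (m ℕ.^ n) * ∑[ i ≤ k ] g (toℕ i)
      ≈⟨ R.*-congˡ (∇-binomial k (λ j → x j ^ n)) ⟨
    fromℕ (m ℕ.^ n) * ∇ k (λ j → x j ^ n)  ∎
    where
    f g : Series
    f i = fromℕ (k C i) * (- 1#) ^ (k ∸ i) * (fromℕ (m ℕ.* i) - a) ^ n
    g i = fromℕ (k C i) * (- 1#) ^ i * x i ^ n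

    term : ∀ i → i ℕ.≤ k → (- 1#) ^ k * f i ≈ fromℕ (m ℕ.^ n) * g i
    term i i≤k = begin
      (- 1#) ^ k * (fromℕ (k C i) * (- 1#) ^ (k ∸ i) * (fromℕ (m ℕ.* i) - a) ^ n)
        ≈⟨ ≗⇒≈ (λ s → solve 4 (λ e c f y → e :* (c :* f :* y) := y :* (c :* (e :* f))) refl
                  (seq ((- 1#) ^ k) s) (seq (fromℕ (k C i)) s) (seq ((- 1#) ^ (k ∸ i)) s)
                  (seq ((fromℕ (m ℕ.* i) - a) ^ n) s)) ⟩
      (fromℕ (m ℕ.* i) - a) ^ n * (fromℕ (k C i) * ((- 1#) ^ k * (- 1#) ^ (k ∸ i)))
        ≈⟨ R.*-cong (R.trans (^-congˡ n (m*x i)) (^-distrib-* (fromℕ m) (x i) n))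
             (R.*-congˡ (-1^-cancel i≤k)) ⟩
      fromℕ m ^ n * x i ^ n * (fromℕ (k C i) * (- 1#) ^ i)
        ≈⟨ R.*-congʳ (R.*-congʳ (fromℕ-homo-^ m n)) ⟨
      fromℕ (m ℕ.^ n) * x i ^ n * (fromℕ (k C i) * (- 1#) ^ i)
        ≈⟨ ≗⇒≈ (λ s → solve 4 (λ p y c e → p :* y :* (c :* e) := p :* (c :* e :* y)) refl
                  (seq (fromℕ (m ℕ.^ n)) s) (seq (x i ^ n) s) (seq (fromℕ (k C i)) s)
                  (seq ((- 1#) ^ i) s)) ⟩
      fromℕ (m ℕ.^ n) * (fromℕ (k C i) * (- 1#) ^ i * x i ^ n)  ∎

  -- The factors k!, m^k and m^{n-k} cancel against mⁿ from `whitneySum≈∇` and the k! in front,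
  -- leaving only the divisor k+1.
  whitneyTerm : ∀ {n k} → k ℕ.≤ n →
    fromℕ (k !) * noncentralWhitney m a n k *
    ((- 1#) ^ k / (m ℕ.^ (n ∸ k) ℕ.* suc k)) {{m^i*j≢0 m (n ∸ k) (suc k)}} ≈
    ∇ k (λ j → x j ^ n) / suc k
  whitneyTerm {n} {k} k≤n = /-unique (suc k) (begin
    fromℕ (suc k) * (fromℕ (k !) * (1# * r * W) * ((- 1#) ^ k * r′))
      ≈⟨ ≗⇒≈ (λ s → solve 6 (λ c f r w e r′ → c :* (f :* (con 1ℚ :* r :* w) :* (e :* r′))
                                := c :* f :* (r :* r′) :* (e :* w)) refl
                (seq (fromℕ (suc k)) s) (seq (fromℕ (k !)) s) (seq r s) (seq W s)
                (seq ((- 1#) ^ k) s) (seq r′ s)) ⟩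
    fromℕ (suc k) * fromℕ (k !) * (r * r′) * ((- 1#) ^ k * W)
      ≈⟨ R.*-congˡ (whitneySum≈∇ n k) ⟩
    fromℕ (suc k) * fromℕ (k !) * (r * r′) * (fromℕ (m ℕ.^ n) * D)
      ≈⟨ ≗⇒≈ (λ s → solve 6 (λ c f r r′ p d → c :* f :* (r :* r′) :* (p :* d)
                                := c :* f :* p :* (r :* r′) :* d) refl
                (seq (fromℕ (suc k)) s) (seq (fromℕ (k !)) s) (seq r s) (seq r′ s)
                (seq (fromℕ (m ℕ.^ n)) s) (seq D s)) ⟩
    fromℕ (suc k) * fromℕ (k !) * fromℕ (m ℕ.^ n) * (r * r′) * D
      ≈⟨ R.*-congʳ (R.*-congʳ denominators) ⟩
    fromℕ d * fromℕ d′ * (r * r′) * D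
      ≈⟨ ≗⇒≈ (λ s → solve 5 (λ d d′ r r′ y → d :* d′ :* (r :* r′) :* y
                                := (d :* r) :* (d′ :* r′) :* y) refl
                (seq (fromℕ d) s) (seq (fromℕ d′) s) (seq r s) (seq r′ s) (seq D s)) ⟩
    (fromℕ d * r) * (fromℕ d′ * r′) * D
      ≈⟨ R.*-congʳ (R.*-cong (fromℕ*recip d {{d≢0}}) (fromℕ*recip d′ {{d′≢0}})) ⟩
    1# * 1# * D
      ≈⟨ ≗⇒≈ (λ s → solve 1 (λ y → con 1ℚ :* con 1ℚ :* y := y) refl (seq D s)) ⟩
    D  ∎)
    where
    d  = m ℕ.^ k ℕ.* k !
    d′ = m ℕ.^ (n ∸ k) ℕ.* suc k
    d≢0  = m^i*j≢0 m k (k !) {{it}} {{k !≢0}}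
    d′≢0 = m^i*j≢0 m (n ∸ k) (suc k)
    r  = recip d {{d≢0}}
    r′ = recip d′ {{d′≢0}}
    W  = whitneySum n k
    D  = ∇ k (λ j → x j ^ n)

    -- With truncated subtraction, k + (n ∸ k) = n needs `k≤n`.
    denominatorsℕ : suc k ℕ.* k ! ℕ.* m ℕ.^ n ≡ d ℕ.* d′
    denominatorsℕ = trans
      (cong (suc k ℕ.* k ! ℕ.*_)
        (trans (cong (m ℕ.^_) (sym (ℕ.m+[n∸m]≡n k≤n))) (ℕ.^-distribˡ-+-* m k (n ∸ k))))
      (ℕS.solve 4 (λ c f p q → c ℕS.:* f ℕS.:* (p ℕS.:* q) ℕS.:= p ℕS.:* f ℕS.:* (q ℕS.:* c))
        refl (suc k) (k !) (m ℕ.^ k) (m ℕ.^ (n ∸ k)))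

    denominators : fromℕ (suc k) * fromℕ (k !) * fromℕ (m ℕ.^ n) ≈ fromℕ d * fromℕ d′
    denominators = begin
      fromℕ (suc k) * fromℕ (k !) * fromℕ (m ℕ.^ n)
        ≈⟨ R.*-congʳ (fromℕ-homo-* (suc k) (k !)) ⟨
      fromℕ (suc k ℕ.* k !) * fromℕ (m ℕ.^ n)
        ≈⟨ fromℕ-homo-* (suc k ℕ.* k !) (m ℕ.^ n) ⟨
      fromℕ (suc k ℕ.* k ! ℕ.* m ℕ.^ n)
        ≡⟨ cong fromℕ denominatorsℕ ⟩
      fromℕ (d ℕ.* d′)
        ≈⟨ fromℕ-homo-* d d′ ⟩
      fromℕ d * fromℕ d′  ∎

corollary3 : (a : ℝ) (m : ℕ) .{{_ : NonZero m}} (n : ℕ) →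
    bernoulli n ((- a) / m) ≈
    ∑[ i ≤ n ] (let k = toℕ i in
    fromℕ (k !) * noncentralWhitney m a n k *
    ((- 1#) ^ k / (m ℕ.^ (n ∸ k) ℕ.* suc k)) {{m^i*j≢0 m (n ∸ k) (suc k)}})
corollary3 a m n = R.trans (bernoulli≈β ((- a) / m) n)
  (R.sym (sum-cong-≋ {suc n} λ i → whitneyTerm a m (ℕ.s≤s⁻¹ (toℕ<n i))))
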